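{- The problem of deciding if a trigger is g-unblockable for a KB and a head-choice is undecidable.
   Context: Setting (restricted disjunctive chase). Rules are of the form $\forall \vec w,\vec x.[\beta(\vec w,\vec x)\to \bigvee_{i=1}^n \exists \vec y_i.\eta_i(\vec x_i,\vec y_i)]$ (constant- and function-free); $\mathrm{branching}(\rho)=n$; $\mathrm{sk}(\rho)$ replaces existential variables $y\in\vec y_i$ by skolem terms $f^\rho_{i,y}(\vec x)$. A trigger $\lambda=(\rho,\sigma)$ is a rule with a substitution on its body variables; loaded for a fact set $F$ if $\mathrm{body}(\rho)\sigma\subseteq F$; obsolete for $F$ if some extension $\sigma'$ of $\sigma$ has $\mathrm{head}_i(\rho)\sigma'\subseteq F$ for some $i$; $\mathrm{out}_i(\lambda)=\mathrm{head}_i(\mathrm{sk}(\rho))\sigma$. A KB is a pair $(\mathcal{R},D)$ of a rule set and a function-free fact set. A chase tree of a KB is a tree rooted at $D$ in which each non-leaf vertex applies an $\mathcal{R}$-trigger that is loaded and not obsolete (datalog triggers first), branching into children labelled with the parent label plus $\mathrm{out}_i(\lambda)$ for each disjunct $i$, leaves satisfy all rules, and application is fair. A head-choice $hc$ maps each rule $\rho$ to an index in $\{1,\dots,\mathrm{branching}(\rho)\}$, $\mathrm{out}_{hc}(\lambda)=\mathrm{out}_{hc(\rho)}(\lambda)$, and $\mathrm{branch}(T,hc)$ is the branch of chase tree $T$ that always follows the child given by $hc$. A trigger $\lambda$ is g-unblockable for a KB $K$ and $hc$ if for every chase tree $T$ of $K$ and every vertex $v$ on $\mathrm{branch}(T,hc)$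 for whose label $\lambda$ is loaded, some vertex $u$ on $\mathrm{branch}(T,hc)$ has $\mathrm{out}_{hc}(\lambda)\subseteq$ label$(u)$. -}

module Defs where

open import Data.Nat using (ℕ; zero; suc; _≟_)
open import Data.Bool using (Bool; true; false)
open import Data.Fin using (Fin; toℕ)
open import Data.List using (List; []; _∷_; _++_; map; concatMap; length; lookup; filter; deduplicate)
open import Data.List.Membership.Propositional using (_∈_)
open import Data.List.Membership.DecPropositional _≟_ using (_∈?_)
open import Data.List.Relation.Binary.Subset.Propositional using (_⊆_)
open import Data.Maybe using (Maybe; just; nothing; _>>=_)
open import Data.Product using (Σ; ∃; ∃-syntax; _×_; _,_)
open import Relation.Binary.PropositionalEquality using (_≡_)
open import Relation.Nullary using (¬_; yes; no)

Var : Set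
Var = ℕ

-- An atom over variables (rules are constant- and function-free).
record VAtom : Set where
  constructor vatom
  field
    pred : ℕ
    args : List Var
open VAtom public

-- A rule  ∀ w x. β → ⋁_{i} ∃ y_i. η_i ; at least one disjunct.
record Rule : Set where
  constructor rule
  field
    body  : List VAtom
    head₀ : List VAtom
    heads : List (List VAtom)
open Rule public

allHeads : Rule → List (List VAtom)
allHeads ρ = head₀ ρ ∷ heads ρ

branching : Rule → ℕ
branching ρ = length (allHeads ρ)

head : (ρ : Rule) → Fin (branching ρ) → List VAtom
head ρ i = lookup (allHeads ρ) i

varsOf : List VAtom → List Var
varsOf = concatMap args

bodyVars : Rule → List Var
bodyVars ρ = varsOf (body ρ)

frontier : Rule → List Var
frontier ρ = deduplicate _≟_ (filter (λ v → v ∈? concatMap varsOf (allHeads ρ)) (bodyVars ρ))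

-- Ground terms: constants and skolem terms f^ρ_{i,y}(t⃗).
data GTerm : Set where
  con : ℕ → GTerm
  fn  : Rule → ℕ → Var → List GTerm → GTerm

record GAtom : Set where
  constructor gatom
  field
    gpred : ℕ
    gargs : List GTerm

record CAtom : Set where
  constructor catom
  field
    cpred : ℕ
    cargs : List ℕ

embed : CAtom → GAtom
embed (catom p cs) = gatom p (map con cs)

FactSet : Set
FactSet = List GAtom

applyAtom : (Var → GTerm) → VAtom → GAtom
applyAtom s (vatom p xs) = gatom p (map s xs)

applyAtoms : (Var → GTerm) → List VAtom → List GAtom
applyAtoms s = map (applyAtom s)

skSub : Rule → ℕ → (Var → GTerm) → Var → GTerm
skSub ρ i s v with v ∈? bodyVars ρ
... | yes _ = s v
... | no  _ = fn ρ i v (map s (frontier ρ))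

-- finite substitution (association list); unassigned variables ↦ con 0
Subst : Set
Subst = List (Var × GTerm)

⟦_⟧ : Subst → Var → GTerm
⟦ [] ⟧ v = con 0
⟦ (x , t) ∷ σ ⟧ v with v ≟ x
... | yes _ = t
... | no  _ = ⟦ σ ⟧ v

record KB : Set where
  constructor kb
  field
    rules : List Rule
    db    : List CAtom
open KB public

record Trigger (K : KB) : Set where
  constructor trigger
  field
    idx : Fin (length (rules K))
    sub : Subst
open Trigger public

module _ {K : KB} where

  ruleOf : Trigger K → Rule
  ruleOf λ′ = lookup (rules K) (idx λ′)

  Loaded : FactSet → Trigger K → Set
  Loaded F λ′ = applyAtoms ⟦ sub λ′ ⟧ (body (ruleOf λ′)) ⊆ F

  Obsolete : FactSet → Trigger K → Set
  Obsolete F λ′ =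
    ∃[ s′ ] ((∀ v → v ∈ bodyVars (ruleOf λ′) → s′ v ≡ ⟦ sub λ′ ⟧ v)
            × ∃[ i ] applyAtoms s′ (head (ruleOf λ′) i) ⊆ F)

  out : (λ′ : Trigger K) → Fin (branching (ruleOf λ′)) → List GAtom
  out λ′ i = applyAtoms (skSub (ruleOf λ′) (toℕ i) ⟦ sub λ′ ⟧) (head (ruleOf λ′) i)

  -- out with a natural-number index (empty when out of range)
  outℕ : Trigger K → ℕ → List GAtom
  outℕ λ′ n = go (allHeads (ruleOf λ′)) n 0
    where
    go : List (List VAtom) → ℕ → ℕ → List GAtom
    go []       _       _ = []
    go (h ∷ hs) zero    k = applyAtoms (skSub (ruleOf λ′) k ⟦ sub λ′ ⟧) h
    go (h ∷ hs) (suc n) k = go hs n (suc k)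

  Datalog : Trigger K → Set
  Datalog λ′ = (heads (ruleOf λ′) ≡ []) × (∀ v → v ∈ varsOf (head₀ (ruleOf λ′)) → v ∈ bodyVars (ruleOf λ′))

  -- vertices are addressed by lists of child indices (most recent first)
  Addr : Set
  Addr = List ℕ

  -- a tree is given by the trigger applied at each vertex (nothing = leaf)
  TreeData : Set
  TreeData = Addr → Maybe (Trigger K)

  label : TreeData → Addr → FactSet
  label T [] = map embed (db K)
  label T (i ∷ a) with T a
  ... | just λ′ = label T a ++ outℕ λ′ i
  ... | nothing = label T a

  data Vertex (T : TreeData) : Addr → Set where
    root  : Vertex T []
    child : ∀ {a λ′} → Vertex T a → T a ≡ just λ′ →
            (i : Fin (branching (ruleOf λ′))) → Vertex T (toℕ i ∷ a)

  prefix : (ℕ → ℕ) → ℕ → Addr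
  prefix f zero    = []
  prefix f (suc n) = f n ∷ prefix f n

  record IsChaseTree (T : TreeData) : Set where
    field
      applied-ok : ∀ {a λ′} → Vertex T a → T a ≡ just λ′ →
                   Loaded (label T a) λ′ × ¬ Obsolete (label T a) λ′
      datalog-first : ∀ {a λ′} → Vertex T a → T a ≡ just λ′ → ¬ Datalog λ′ →
                   ∀ μ → Datalog μ → Loaded (label T a) μ → Obsolete (label T a) μ
      leaf-model : ∀ {a} → Vertex T a → T a ≡ nothing →
                   ∀ μ → Loaded (label T a) μ → Obsolete (label T a) μ
      fair : (f : ℕ → ℕ) → (∀ n → Vertex T (prefix f n)) →
             ∀ μ n → Loaded (label T (prefix f n)) μ →
             ∃[ m ] Obsolete (label T (prefix f m)) μ

  HeadChoice : Set
  HeadChoice = (k : Fin (length (rules K))) → Fin (branching (lookup (rules K) k))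

  outHc : HeadChoice → (λ′ : Trigger K) → List GAtom
  outHc hc λ′ = out λ′ (hc (idx λ′))

  data OnBranch (T : TreeData) (hc : HeadChoice) : Addr → Set where
    root : OnBranch T hc []
    step : ∀ {a λ′} → OnBranch T hc a → T a ≡ just λ′ →
           OnBranch T hc (toℕ (hc (idx λ′)) ∷ a)

  GUnblockable : HeadChoice → Trigger K → Set
  GUnblockable hc λ′ =
    ∀ (T : TreeData) → IsChaseTree T →
    ∀ v → OnBranch T hc v → Loaded (label T v) λ′ →
    ∃[ u ] (OnBranch T hc u × outHc hc λ′ ⊆ label T u)

record Instance : Set where
  constructor inst
  field
    K   : KB
    hc  : HeadChoice {K}
    trg : Trigger K

GUProblem : Instance → Set
GUProblem (inst K hc λ′) = GUnblockable {K} hc λ′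

-- Turing machines (binary alphabet, false = blank), halting on empty tape

data Move : Set where
  L R : Move

record TM : Set where
  field
    nstates : ℕ                     -- states Fin (suc nstates), start = zero
    δ : Fin (suc nstates) → Bool → Maybe (Fin (suc nstates) × Bool × Move)
open TM public

record Config (M : TM) : Set where
  constructor cfg
  field
    state : Fin (suc (nstates M))
    left  : List Bool
    cur   : Bool
    right : List Bool

module _ {M : TM} where
  move : Move → List Bool → Bool → List Bool → Config M → Fin (suc (nstates M)) → Config M
  move L []       b r _ q = cfg q [] false (b ∷ r)
  move L (x ∷ l)  b r _ q = cfg q l x (b ∷ r)
  move R l b []       _ q = cfg q (b ∷ l) false []
  move R l b (x ∷ r)  _ q = cfg q (b ∷ l) x r

  stepTM : Config M → Maybe (Config M)
  stepTM c@(cfg q l x r) with δ M q x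
  ... | nothing = nothing
  ... | just (q′ , b , d) = just (move d l b r c q′)

  run : ℕ → Config M → Maybe (Config M)
  run zero    c = just c
  run (suc k) c = stepTM c >>= run k

initial : (M : TM) → Config M
initial M = cfg Fin.zero [] false []
  where import Data.Fin as Fin

Halts : TM → Set
Halts M = ∃[ k ] run (suc k) (initial M) ≡ nothing

-- Reduction from halting on the empty tape. The knowledge base of a machine M encodes its
-- configurations as facts; every transition rule has the disjunct performing one step of M and a
-- second disjunct stop, which makes all triggers obsolete. A halting configuration derives halted,
-- and the trigger asked about is that of halted ⇒ (∃y. goal(y)) ∨ stop under the head-choice that
-- always takes the first disjunct.
-- If M never halts, reading terms as tapes shows that every fact on that branch of any chase tree
-- describes a reachable configuration, so halted never appears and the trigger is never loaded.
-- If M halts, the chase tree that runs M along its first branch and then applies the datalog rule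
-- halted ⇒ stop loads the trigger but never derives goal; the tick fact in each transition head,
-- whose time term is always new, keeps the transition triggers from being obsolete.

module Submission where

open import Defs
open import Data.Bool using (Bool; true; false; if_then_else_)
open import Data.Empty using (⊥; ⊥-elim)
open import Data.Fin using (Fin; toℕ; combine) renaming (zero to fzero; suc to fsuc)
open import Data.Fin.Properties using (toℕ-injective; combine-injective; toℕ<n)
open import Data.List using (List; []; _∷_; _++_; map; concatMap; allFin; length; replicate)
open import Data.List.Membership.Propositional using (_∈_; lose)
open import Data.List.Membership.Propositional.Properties
  using (∈-++⁻; ∈-++⁺ˡ; ∈-++⁺ʳ; ∈-concatMap⁻; ∈-concatMap⁺; ∈-allFin; ∈-lookup)
open import Data.List.Properties using (length-replicate)
open import Data.List.Relation.Binary.Subset.Propositional using (_⊆_)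
open import Data.List.Relation.Unary.Any using (here; there; index; satisfied)
open import Data.List.Relation.Unary.Any.Properties using (lookup-index)
open import Data.Maybe using (Maybe; just; nothing; _>>=_)
open import Data.Maybe.Properties using (just-injective)
open import Data.Nat using (ℕ; zero; suc; _≡ᵇ_; _+_; _≤_; _<_; _≤′_; ≤′-reflexive; ≤′-step; z≤n; s≤s)
open import Data.Nat.Properties using (n<1⇒n≡0; m<n⇒m<1+n; m≤n⇒m≤1+n; ≤-refl; n≮n; ≤⇒≤′; _≤?_; ≰⇒>)
open import Data.Product using (Σ; ∃; ∃-syntax; _×_; _,_; proj₁; proj₂)
open import Data.Sum using (_⊎_; inj₁; inj₂)
open import Data.Unit using (⊤; tt)
open import Function.Base using (_∘_)
open import Function.Bundles using (_⇔_; mk⇔)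
open import Relation.Binary.PropositionalEquality
open import Relation.Nullary using (¬_; yes; no)

Holds : (GAtom → Set) → FactSet → Set
Holds P F = ∀ {a} → a ∈ F → P a

module _ {K : KB} where

  label-child : (T : TreeData {K}) (a : List ℕ) {λ′ : Trigger K} (i : ℕ) →
                T a ≡ just λ′ → label T (i ∷ a) ≡ label T a ++ outℕ λ′ i
  label-child T a i eq rewrite eq = refl

  branch⇒vertex : ∀ {T hc a} → OnBranch {K} T hc a → Vertex T a
  branch⇒vertex root = root
  branch⇒vertex {hc = hc} (step {λ′ = λ′} ob e) = child (branch⇒vertex ob) e (hc (idx λ′))

  Preserves : HeadChoice {K} → (GAtom → Set) → Set
  Preserves hc P = ∀ (λ′ : Trigger K) → Holds P (applyAtoms ⟦ sub λ′ ⟧ (body (ruleOf λ′))) →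
                   Holds P (outℕ λ′ (toℕ (hc (idx λ′))))

  branch-invariant : ∀ hc P → Holds P (map embed (db K)) → Preserves hc P →
                     ∀ T → IsChaseTree {K} T → ∀ {v} → OnBranch T hc v → Holds P (label T v)
  branch-invariant hc P holdsD preserves T ct root = holdsD
  branch-invariant hc P holdsD preserves T ct (step {a} {λ′} ob e) m
    with ∈-++⁻ (label T a) (subst (_ ∈_) (label-child T a (toℕ (hc (idx λ′))) e) m)
  ... | inj₁ m₁ = branch-invariant hc P holdsD preserves T ct ob m₁
  ... | inj₂ m₂ = preserves λ′ (λ mb → branch-invariant hc P holdsD preserves T ct ob (loaded mb)) m₂
    where loaded = proj₁ (IsChaseTree.applied-ok ct (branch⇒vertex ob) e)

  gunblockable-if-never-loaded : ∀ hc P (λ′ : Trigger K) → Holds P (map embed (db K)) → Preserves hc P →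
    ¬ Holds P (applyAtoms ⟦ sub λ′ ⟧ (body (ruleOf λ′))) → GUnblockable {K} hc λ′
  gunblockable-if-never-loaded hc P λ′ holdsD preserves ¬holds T ct v ob loaded =
    ⊥-elim (¬holds (λ m → branch-invariant hc P holdsD preserves T ct ob (loaded m)))

  length-prefix : ∀ f n → length (prefix {K} f n) ≡ n
  length-prefix f zero    = refl
  length-prefix f (suc n) = cong suc (length-prefix f n)

  fair-if-shallow : ∀ {T : TreeData {K}} N → (∀ {a} → Vertex T a → length a ≤ N) →
    (f : ℕ → ℕ) → (∀ n → Vertex T (prefix {K} f n)) →
    ∀ (μ : Trigger K) n → Loaded (label T (prefix {K} f n)) μ → ∃[ m ] Obsolete (label T (prefix {K} f m)) μ
  fair-if-shallow N shallow f path μ n _ =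
    ⊥-elim (n≮n N (subst (_≤ N) (length-prefix f (suc N)) (shallow (path (suc N)))))

  leftmost : HeadChoice {K}
  leftmost _ = fzero

  zeros : ℕ → List ℕ
  zeros j = replicate j 0

  leftmost-branch : ∀ {T u} → OnBranch {K} T leftmost u → u ≡ zeros (length u)
  leftmost-branch root        = refl
  leftmost-branch (step ob _) = cong (0 ∷_) (leftmost-branch ob)

  allZero : List ℕ → Bool
  allZero []          = true
  allZero (zero ∷ a)  = allZero a
  allZero (suc _ ∷ _) = false

  linear : (ℕ → Maybe (Trigger K)) → TreeData {K}
  linear sched a = if allZero a then sched (length a) else nothing

  module Linear (sched : ℕ → Maybe (Trigger K)) where

    allZero-zeros : ∀ j → allZero (zeros j) ≡ true
    allZero-zeros zero    = refl
    allZero-zeros (suc j) = allZero-zeros j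

    linear-zeros : ∀ j → linear sched (zeros j) ≡ sched j
    linear-zeros j rewrite allZero-zeros j | length-replicate j {0} = refl

    allZero⇒zeros : ∀ a → allZero a ≡ true → a ≡ zeros (length a)
    allZero⇒zeros []          _  = refl
    allZero⇒zeros (zero ∷ a)  eq = cong (0 ∷_) (allZero⇒zeros a eq)
    allZero⇒zeros (suc _ ∷ a) ()

    linear-just : ∀ a {λ′} → linear sched a ≡ just λ′ → a ≡ zeros (length a) × sched (length a) ≡ just λ′
    linear-just a eq with allZero a in allZero-a
    ... | true  = allZero⇒zeros a allZero-a , eq

    pathLabel : ℕ → FactSet
    pathLabel j = label (linear sched) (zeros j)

    pathLabel-suc : ∀ j {λ′} → sched j ≡ just λ′ → pathLabel (suc j) ≡ pathLabel j ++ outℕ λ′ 0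
    pathLabel-suc j eq = label-child (linear sched) (zeros j) 0 (trans (linear-zeros j) eq)

    pathLabel-stuck : ∀ j → sched j ≡ nothing → pathLabel (suc j) ≡ pathLabel j
    pathLabel-stuck j eq rewrite linear-zeros j | eq = refl

    zeros-on-branch : ∀ j → (∀ i → i < j → ∃ λ λ′ → sched i ≡ just λ′) →
                      OnBranch (linear sched) leftmost (zeros j)
    zeros-on-branch zero    _       = root
    zeros-on-branch (suc j) defined =
      step (zeros-on-branch j (λ i i<j → defined i (m<n⇒m<1+n i<j)))
           (trans (linear-zeros j) (proj₂ (defined j ≤-refl)))

    vertex-depth : ∀ N → (∀ i {λ′} → sched i ≡ just λ′ → i < N) →
                   ∀ {a} → Vertex (linear sched) a → length a ≤ N
    vertex-depth N bounded root = z≤n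
    vertex-depth N bounded (child {a} _ e _) = bounded (length a) (proj₂ (linear-just a e))

module _ {M : TM} where

  Reachable : Config M → Set
  Reachable c = ∃[ k ] run k (initial M) ≡ just c

  run-suc : ∀ k c₀ {c} → run {M} k c₀ ≡ just c → run (suc k) c₀ ≡ stepTM c
  run-suc zero c₀ refl with stepTM {M} c₀
  ... | just _  = refl
  ... | nothing = refl
  run-suc (suc k) c₀ e with stepTM {M} c₀
  ... | just c₁ = run-suc k c₁ e

  reachable-step : ∀ {c c′} → Reachable c → stepTM {M} c ≡ just c′ → Reachable c′
  reachable-step (k , e) e′ = suc k , trans (run-suc k _ e) e′

  stepTM-moves : ∀ {q l x r q′ b d} → δ M q x ≡ just (q′ , b , d) →
                 stepTM {M} (cfg q l x r) ≡ just (move d l b r (cfg q l x r) q′)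
  stepTM-moves e rewrite e = refl

  stepTM-halts : ∀ {q l x r} → δ M q x ≡ nothing → stepTM {M} (cfg q l x r) ≡ nothing
  stepTM-halts e rewrite e = refl

-- A configuration of state q, scanned bit x and tapes l, r reached at time t is the fact
-- conf (code q x) (t, l, r); a tape is a chain of facts cell b (c, c′) closed by end (c);
-- tick (t, t′) records that time t was followed by time t′.
data Symbol : Set where
  end                   : Symbol
  cell                  : Bool → Symbol
  halted goal stop tick : Symbol
  conf                  : ℕ → Symbol

#_ : Symbol → ℕ
# end        = 0
# cell false = 1
# cell true  = 2
# halted     = 3
# goal       = 4
# stop       = 5
# tick       = 6
# conf m     = 7 + m

decode : ℕ → Symbol
decode 0 = end
decode 1 = cell false
decode 2 = cell true
decode 3 = halted
decode 4 = goal
decode 5 = stop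
decode 6 = tick
decode (suc (suc (suc (suc (suc (suc (suc m))))))) = conf m

decode-# : ∀ s → decode (# s) ≡ s
decode-# end          = refl
decode-# (cell false) = refl
decode-# (cell true)  = refl
decode-# halted       = refl
decode-# goal         = refl
decode-# stop         = refl
decode-# tick         = refl
decode-# (conf m)     = refl

_⟨_⟩ : Symbol → List Var → VAtom
s ⟨ xs ⟩ = vatom (# s) xs

-- A record, so that the atom can be inferred from the type.
record OnSymbols (P : Symbol → List GTerm → Set) (a : GAtom) : Set where
  constructor ⟪_⟫
  field holds : P (decode (GAtom.gpred a)) (GAtom.gargs a)
open OnSymbols public

onSymbols⁺ : ∀ {P} s {ts} → P s ts → OnSymbols P (gatom (# s) ts)
onSymbols⁺ {P} s {ts} h = ⟪ subst (λ s′ → P s′ ts) (sym (decode-# s)) h ⟫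

onSymbols⁻ : ∀ {P} s {ts} → OnSymbols P (gatom (# s) ts) → P s ts
onSymbols⁻ {P} s {ts} h = subst (λ s′ → P s′ ts) (decode-# s) (holds h)

bitFin : Bool → Fin 2
bitFin false = fzero
bitFin true  = fsuc fzero

bitFin-injective : ∀ {x y} → bitFin x ≡ bitFin y → x ≡ y
bitFin-injective {false} {false} _ = refl
bitFin-injective {true}  {true}  _ = refl
bitFin-injective {false} {true}  ()
bitFin-injective {true}  {false} ()

module Reduction (M : TM) where

  State : Set
  State = Fin (suc (nstates M))

  confCode : State → Bool → ℕ
  confCode q x = toℕ (combine q (bitFin x))

  confCode-injective : ∀ {q x q′ x′} → confCode q x ≡ confCode q′ x′ → q ≡ q′ × x ≡ x′
  confCode-injective {q} {x} {q′} {x′} e with combine-injective q (bitFin x) q′ (bitFin x′) (toℕ-injective e)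
  ... | q≡q′ , x≡x′ = q≡q′ , bitFin-injective x≡x′

  confAt : State → Bool → Symbol
  confAt q x = conf (confCode q x)

  stopDisjunct : List (List VAtom)
  stopDisjunct = (stop ⟨ [] ⟩ ∷ []) ∷ []

  halted⇒stop : Rule
  halted⇒stop = rule (halted ⟨ [] ⟩ ∷ []) (stop ⟨ [] ⟩ ∷ []) []

  halted⇒goal∨stop : Rule
  halted⇒goal∨stop = rule (halted ⟨ [] ⟩ ∷ []) (goal ⟨ 0 ∷ [] ⟩ ∷ []) stopDisjunct

  halt : State → Bool → Rule
  halt q x = rule (confAt q x ⟨ 0 ∷ 1 ∷ 2 ∷ [] ⟩ ∷ []) (halted ⟨ [] ⟩ ∷ []) stopDisjunct

  -- Variables: 0 the current time, 1 and 2 the left and right tape, 3 the rest of the tape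
  -- being read, 4 the next time and 5 the newly written cell.
  moveRule : State → Bool → (scanned next written : VAtom) → Rule
  moveRule q x scanned next written =
    rule (confAt q x ⟨ 0 ∷ 1 ∷ 2 ∷ [] ⟩ ∷ scanned ∷ [])
         (next ∷ written ∷ tick ⟨ 0 ∷ 4 ∷ [] ⟩ ∷ []) stopDisjunct

  shiftRightAtEnd shiftLeftAtEnd : State → Bool → State → Bool → Rule
  shiftRightAtEnd q x q′ b =
    moveRule q x (end ⟨ 2 ∷ [] ⟩) (confAt q′ false ⟨ 4 ∷ 5 ∷ 2 ∷ [] ⟩) (cell b ⟨ 5 ∷ 1 ∷ [] ⟩)
  shiftLeftAtEnd q x q′ b =
    moveRule q x (end ⟨ 1 ∷ [] ⟩) (confAt q′ false ⟨ 4 ∷ 1 ∷ 5 ∷ [] ⟩) (cell b ⟨ 5 ∷ 2 ∷ [] ⟩)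

  shiftRight shiftLeft : State → Bool → State → Bool → Bool → Rule
  shiftRight q x q′ b x′ =
    moveRule q x (cell x′ ⟨ 2 ∷ 3 ∷ [] ⟩) (confAt q′ x′ ⟨ 4 ∷ 5 ∷ 3 ∷ [] ⟩) (cell b ⟨ 5 ∷ 1 ∷ [] ⟩)
  shiftLeft q x q′ b x′ =
    moveRule q x (cell x′ ⟨ 1 ∷ 3 ∷ [] ⟩) (confAt q′ x′ ⟨ 4 ∷ 3 ∷ 5 ∷ [] ⟩) (cell b ⟨ 5 ∷ 2 ∷ [] ⟩)

  transitionRules : State → Bool → Maybe (State × Bool × Move) → List Rule
  transitionRules q x nothing = halt q x ∷ []
  transitionRules q x (just (q′ , b , R)) =
    shiftRightAtEnd q x q′ b ∷ shiftRight q x q′ b false ∷ shiftRight q x q′ b true ∷ []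
  transitionRules q x (just (q′ , b , L)) =
    shiftLeftAtEnd q x q′ b ∷ shiftLeft q x q′ b false ∷ shiftLeft q x q′ b true ∷ []

  rulesAt : State → List Rule
  rulesAt q = transitionRules q false (δ M q false) ++ transitionRules q true (δ M q true)

  rulesM : List Rule
  rulesM = halted⇒stop ∷ halted⇒goal∨stop ∷ concatMap rulesAt (allFin _)

  KM : KB
  KM = kb rulesM (catom (# confAt fzero false) (0 ∷ 0 ∷ 0 ∷ []) ∷ catom (# end) (0 ∷ []) ∷ [])

  transition∈rules : ∀ q x {m ρ} → δ M q x ≡ m → ρ ∈ transitionRules q x m → ρ ∈ rulesM
  transition∈rules q false refl p = there (there (∈-concatMap⁺ rulesAt (lose (∈-allFin q) (∈-++⁺ˡ p))))
  transition∈rules q true  refl p =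
    there (there (∈-concatMap⁺ rulesAt (lose (∈-allFin q) (∈-++⁺ʳ (transitionRules q false _) p))))

  shiftRight∈ : ∀ {q x q′ b} x′ → shiftRight q x q′ b x′ ∈ transitionRules q x (just (q′ , b , R))
  shiftRight∈ false = there (here refl)
  shiftRight∈ true  = there (there (here refl))

  shiftLeft∈ : ∀ {q x q′ b} x′ → shiftLeft q x q′ b x′ ∈ transitionRules q x (just (q′ , b , L))
  shiftLeft∈ false = there (here refl)
  shiftLeft∈ true  = there (there (here refl))

  module RuleInduction (P : Rule → Set) (p-stop : P halted⇒stop) (p-goal : P halted⇒goal∨stop)
    (p-halt : ∀ {q x} → δ M q x ≡ nothing → P (halt q x))
    (p-rightAtEnd : ∀ {q x q′ b} → δ M q x ≡ just (q′ , b , R) → P (shiftRightAtEnd q x q′ b))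
    (p-right : ∀ {q x q′ b} x′ → δ M q x ≡ just (q′ , b , R) → P (shiftRight q x q′ b x′))
    (p-leftAtEnd : ∀ {q x q′ b} → δ M q x ≡ just (q′ , b , L) → P (shiftLeftAtEnd q x q′ b))
    (p-left : ∀ {q x q′ b} x′ → δ M q x ≡ just (q′ , b , L) → P (shiftLeft q x q′ b x′)) where

    transition : ∀ q x {m ρ} → δ M q x ≡ m → ρ ∈ transitionRules q x m → P ρ
    transition q x {nothing}            e (here refl)                = p-halt e
    transition q x {just (q′ , b , R)} e (here refl)                = p-rightAtEnd e
    transition q x {just (q′ , b , R)} e (there (here refl))        = p-right false e
    transition q x {just (q′ , b , R)} e (there (there (here refl))) = p-right true e
    transition q x {just (q′ , b , L)} e (here refl)                = p-leftAtEnd e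
    transition q x {just (q′ , b , L)} e (there (here refl))        = p-left false e
    transition q x {just (q′ , b , L)} e (there (there (here refl))) = p-left true e

    induction : ∀ {ρ} → ρ ∈ rulesM → P ρ
    induction (here refl)         = p-stop
    induction (there (here refl)) = p-goal
    induction (there (there p)) with satisfied (∈-concatMap⁻ rulesAt {xs = allFin _} p)
    ... | q , p′ with ∈-++⁻ (transitionRules q false (δ M q false)) p′
    ...   | inj₁ p₁ = transition q false refl p₁
    ...   | inj₂ p₂ = transition q true refl p₂

  datalog-body : ∀ {ρ} → ρ ∈ rulesM → heads ρ ≡ [] → body ρ ≡ halted ⟨ [] ⟩ ∷ []
  datalog-body = RuleInduction.induction (λ ρ → heads ρ ≡ [] → body ρ ≡ halted ⟨ [] ⟩ ∷ [])
    (λ _ → refl) (λ ()) (λ _ ()) (λ _ ()) (λ _ _ ()) (λ _ ()) (λ _ _ ())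

  heads-cases : ∀ {ρ} → ρ ∈ rulesM → heads ρ ≡ [] ⊎ heads ρ ≡ stopDisjunct
  heads-cases = RuleInduction.induction (λ ρ → heads ρ ≡ [] ⊎ heads ρ ≡ stopDisjunct)
    (inj₁ refl) (inj₂ refl) (λ _ → inj₂ refl) (λ _ → inj₂ refl) (λ _ _ → inj₂ refl)
    (λ _ → inj₂ refl) (λ _ _ → inj₂ refl)

  stop-disjunct : ∀ {ρ} → ρ ∈ rulesM → ∃ λ (i : Fin (branching ρ)) → head ρ i ≡ stop ⟨ [] ⟩ ∷ []
  stop-disjunct = RuleInduction.induction (λ ρ → ∃ λ (i : Fin (branching ρ)) → head ρ i ≡ stop ⟨ [] ⟩ ∷ [])
    (fzero , refl) (fsuc fzero , refl) (λ _ → fsuc fzero , refl) (λ _ → fsuc fzero , refl)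
    (λ _ _ → fsuc fzero , refl) (λ _ → fsuc fzero , refl) (λ _ _ → fsuc fzero , refl)

  writtenBit : Symbol → Bool
  writtenBit (cell b) = b
  writtenBit _        = false

  writtenBit-# : ∀ b → writtenBit (decode (# cell b)) ≡ b
  writtenBit-# b = cong writtenBit (decode-# (cell b))

  position : ℕ → List ℕ → ℕ
  position v []       = 0
  position v (w ∷ ws) = if v ≡ᵇ w then 0 else suc (position v ws)

  writtenBitOf : Rule → Bool
  writtenBitOf ρ with head₀ ρ
  ... | _ ∷ vatom p _ ∷ _ = writtenBit (decode p)
  ... | _                 = false

  tailPosition : Rule → ℕ
  tailPosition ρ with head₀ ρ
  ... | _ ∷ vatom _ (_ ∷ v ∷ _) ∷ _ = position v (frontier ρ)
  ... | _                           = 0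

  -- A skolem term made by a transition rule denotes the bit that rule writes followed by the tape
  -- of the successor cell in its written fact, found among the skolem arguments (the frontier).
  -- Constants denote the empty tape; time terms get a meaningless tape.
  mutual
    tape : GTerm → List Bool
    tape (con _)        = []
    tape (fn ρ _ _ ts)  = writtenBitOf ρ ∷ tapeAt (tailPosition ρ) ts

    tapeAt : ℕ → List GTerm → List Bool
    tapeAt _       []       = []
    tapeAt zero    (t ∷ _)  = tape t
    tapeAt (suc k) (_ ∷ ts) = tapeAt k ts

  GoodAt : Symbol → List GTerm → Set
  GoodAt end      (c ∷ [])          = tape c ≡ []
  GoodAt (cell b) (c ∷ c′ ∷ [])     = tape c ≡ b ∷ tape c′
  GoodAt halted   []                = Halts M
  GoodAt (conf m) (_ ∷ l ∷ r ∷ [])  =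
    ∃[ q ] ∃[ x ] (confCode q x ≡ m × Reachable {M} (cfg q (tape l) x (tape r)))
  GoodAt _        _                 = ⊤

  Good : GAtom → Set
  Good = OnSymbols GoodAt

  conf-good⁺ : ∀ {q x t l r L R} → Reachable {M} (cfg q L x R) → tape l ≡ L → tape r ≡ R →
               Good (gatom (# confAt q x) (t ∷ l ∷ r ∷ []))
  conf-good⁺ {q} {x} reached refl refl = ⟪ q , x , refl , reached ⟫

  conf-good⁻ : ∀ {q x t l r L R} → Good (gatom (# confAt q x) (t ∷ l ∷ r ∷ [])) → tape l ≡ L → tape r ≡ R →
               Reachable {M} (cfg q L x R)
  conf-good⁻ {q} {x} ⟪ q₀ , x₀ , code≡ , reached ⟫ refl refl with confCode-injective {q₀} {x₀} {q} {x} code≡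
  ... | refl , refl = reached

  cell-good⁺ : ∀ b {c c′} → tape c ≡ writtenBit (decode (# cell b)) ∷ tape c′ →
               Good (gatom (# cell b) (c ∷ c′ ∷ []))
  cell-good⁺ b e = onSymbols⁺ (cell b) (trans e (cong (_∷ _) (writtenBit-# b)))

  cell-good⁻ : ∀ b {c c′} → Good (gatom (# cell b) (c ∷ c′ ∷ [])) → tape c ≡ b ∷ tape c′
  cell-good⁻ b = onSymbols⁻ (cell b)

  Sound : Rule → Set
  Sound ρ = ∀ s → Holds Good (applyAtoms s (body ρ)) → Holds Good (applyAtoms (skSub ρ 0 s) (head₀ ρ))

  sound-halt : ∀ {q x} → δ M q x ≡ nothing → Sound (halt q x)
  sound-halt e s good (here refl) with conf-good⁻ (good (here refl)) refl refl
  ... | k , reached = ⟪ k , trans (run-suc k _ reached) (stepTM-halts {M} e) ⟫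

  sound-rightAtEnd : ∀ {q x q′ b} → δ M q x ≡ just (q′ , b , R) → Sound (shiftRightAtEnd q x q′ b)
  sound-rightAtEnd {b = b} e s good (here refl) =
    conf-good⁺ (reachable-step (conf-good⁻ (good (here refl)) refl atEnd) (stepTM-moves {M} e))
               (cong (_∷ _) (writtenBit-# b)) atEnd
    where atEnd = holds (good (there (here refl)))
  sound-rightAtEnd {b = b} e s good (there (here refl)) = cell-good⁺ b refl
  sound-rightAtEnd e s good (there (there (here refl))) = ⟪ tt ⟫

  sound-right : ∀ {q x q′ b} x′ → δ M q x ≡ just (q′ , b , R) → Sound (shiftRight q x q′ b x′)
  sound-right {b = b} x′ e s good (here refl) =
    conf-good⁺ (reachable-step (conf-good⁻ (good (here refl)) refl (cell-good⁻ x′ (good (there (here refl)))))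
                               (stepTM-moves {M} e))
               (cong (_∷ _) (writtenBit-# b)) refl
  sound-right {b = b} x′ e s good (there (here refl)) = cell-good⁺ b refl
  sound-right x′ e s good (there (there (here refl))) = ⟪ tt ⟫

  sound-leftAtEnd : ∀ {q x q′ b} → δ M q x ≡ just (q′ , b , L) → Sound (shiftLeftAtEnd q x q′ b)
  sound-leftAtEnd {b = b} e s good (here refl) =
    conf-good⁺ (reachable-step (conf-good⁻ (good (here refl)) atEnd refl) (stepTM-moves {M} e))
               atEnd (cong (_∷ _) (writtenBit-# b))
    where atEnd = holds (good (there (here refl)))
  sound-leftAtEnd {b = b} e s good (there (here refl)) = cell-good⁺ b refl
  sound-leftAtEnd e s good (there (there (here refl))) = ⟪ tt ⟫

  sound-left : ∀ {q x q′ b} x′ → δ M q x ≡ just (q′ , b , L) → Sound (shiftLeft q x q′ b x′)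
  sound-left {b = b} x′ e s good (here refl) =
    conf-good⁺ (reachable-step (conf-good⁻ (good (here refl)) (cell-good⁻ x′ (good (there (here refl)))) refl)
                               (stepTM-moves {M} e))
               refl (cong (_∷ _) (writtenBit-# b))
  sound-left {b = b} x′ e s good (there (here refl)) = cell-good⁺ b refl
  sound-left x′ e s good (there (there (here refl))) = ⟪ tt ⟫

  rules-sound : ∀ {ρ} → ρ ∈ rulesM → Sound ρ
  rules-sound = RuleInduction.induction Sound
    (λ { s good (here refl) → ⟪ tt ⟫ }) (λ { s good (here refl) → ⟪ tt ⟫ })
    sound-halt sound-rightAtEnd sound-right sound-leftAtEnd sound-left

  leftmost-preserves-good : Preserves {KM} (leftmost {KM}) Good
  leftmost-preserves-good λ′ = rules-sound (∈-lookup (idx λ′)) ⟦ sub λ′ ⟧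

  database-good : Holds Good (map embed (db KM))
  database-good (here refl)         = conf-good⁺ (0 , refl) refl refl
  database-good (there (here refl)) = ⟪ refl ⟫

  goalTrigger : Trigger KM
  goalTrigger = trigger (fsuc fzero) []

  nonhalting⇒gunblockable : ¬ Halts M → GUnblockable {KM} (leftmost {KM}) goalTrigger
  nonhalting⇒gunblockable ¬halts =
    gunblockable-if-never-loaded (leftmost {KM}) Good goalTrigger database-good leftmost-preserves-good
      (λ good → ¬halts (holds (good (here refl))))

  triggerAt : ∀ {ρ} → ρ ∈ rulesM → Subst → Trigger KM
  triggerAt p σ = trigger (index p) σ

  ruleOf-triggerAt : ∀ {ρ} (p : ρ ∈ rulesM) σ → ruleOf (triggerAt p σ) ≡ ρ
  ruleOf-triggerAt p σ = sym (lookup-index p)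

  LoadedRule : FactSet → Rule → Subst → Set
  LoadedRule F ρ σ = applyAtoms ⟦ σ ⟧ (body ρ) ⊆ F

  ObsoleteRule : FactSet → Rule → Subst → Set
  ObsoleteRule F ρ σ = Σ (Var → GTerm) λ s′ → (∀ v → v ∈ bodyVars ρ → s′ v ≡ ⟦ σ ⟧ v) ×
                       ∃ λ (i : Fin (branching ρ)) → applyAtoms s′ (head ρ i) ⊆ F

  loaded-triggerAt : ∀ {ρ} (p : ρ ∈ rulesM) σ {F} → LoadedRule F ρ σ → Loaded F (triggerAt p σ)
  loaded-triggerAt p σ {F} = subst (λ ρ → LoadedRule F ρ σ) (sym (ruleOf-triggerAt p σ))

  obsolete-triggerAt : ∀ {ρ} (p : ρ ∈ rulesM) σ {F} → Obsolete F (triggerAt p σ) → ObsoleteRule F ρ σ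
  obsolete-triggerAt p σ {F} = subst (λ ρ → ObsoleteRule F ρ σ) (ruleOf-triggerAt p σ)

  out-triggerAt : ∀ {ρ} (p : ρ ∈ rulesM) σ → outℕ (triggerAt p σ) 0 ≡ applyAtoms (skSub ρ 0 ⟦ σ ⟧) (head₀ ρ)
  out-triggerAt p σ = cong (λ ρ → applyAtoms (skSub ρ 0 ⟦ σ ⟧) (head₀ ρ)) (ruleOf-triggerAt p σ)

  depth : GTerm → ℕ
  depth (con _)            = 0
  depth (fn _ _ _ [])      = 0
  depth (fn _ _ _ (t ∷ _)) = suc (depth t)

  -- The facts present before the simulated step at time j (a time term of depth j) are Fresh j.
  FreshAt : ℕ → Symbol → List GTerm → Set
  FreshAt j halted _              = ⊥
  FreshAt j goal   _              = ⊥
  FreshAt j stop   _              = ⊥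
  FreshAt j tick   (t ∷ _ ∷ [])   = depth t < j
  FreshAt j tick   _              = ⊥
  FreshAt j _      _              = ⊤

  Fresh : ℕ → GAtom → Set
  Fresh j = OnSymbols (FreshAt j)

  freshAt-suc : ∀ {j} s ts → FreshAt j s ts → FreshAt (suc j) s ts
  freshAt-suc end      _              _  = tt
  freshAt-suc (cell _) _              _  = tt
  freshAt-suc (conf _) _              _  = tt
  freshAt-suc tick     (_ ∷ _ ∷ [])   lt = m<n⇒m<1+n lt

  fresh-suc : ∀ {j a} → Fresh j a → Fresh (suc j) a
  fresh-suc {a = gatom p ts} ⟪ h ⟫ = ⟪ freshAt-suc (decode p) ts h ⟫

  -- Its first disjunct would need a fact tick (t, _) for the current time t, its second the fact stop.
  moveRule-not-obsolete : ∀ {j F} q x scanned next written σ → depth (⟦ σ ⟧ 0) ≡ j → Holds (Fresh j) F →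
                          ¬ ObsoleteRule F (moveRule q x scanned next written) σ
  moveRule-not-obsolete {j} _ _ _ _ _ σ depth≡ fresh (s′ , agree , fzero , ⊆F) =
    n≮n j (subst (_< j) (trans (cong depth (agree 0 (here refl))) depth≡)
                        (holds (fresh (⊆F (there (there (here refl)))))))
  moveRule-not-obsolete _ _ _ _ _ σ depth≡ fresh (s′ , agree , fsuc fzero , ⊆F) = holds (fresh (⊆F (here refl)))

  halt-not-obsolete : ∀ {j F q x} σ → Holds (Fresh j) F → ¬ ObsoleteRule F (halt q x) σ
  halt-not-obsolete σ fresh (s′ , agree , fzero      , ⊆F) = holds (fresh (⊆F (here refl)))
  halt-not-obsolete σ fresh (s′ , agree , fsuc fzero , ⊆F) = holds (fresh (⊆F (here refl)))

  move-output-fresh : ∀ q x q′ x′ b {scanned us vs}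
                      (p : moveRule q x scanned (confAt q′ x′ ⟨ us ⟩) (cell b ⟨ vs ⟩) ∈ rulesM) σ →
                      Holds (Fresh (suc (depth (⟦ σ ⟧ 0)))) (outℕ (triggerAt p σ) 0)
  move-output-fresh q x q′ x′ b p σ m with subst (_ ∈_) (out-triggerAt p σ) m
  ... | here refl                 = ⟪ tt ⟫
  ... | there (here refl)         = onSymbols⁺ (cell b) tt
  ... | there (there (here refl)) = ⟪ ≤-refl ⟫

  TermTape : Set
  TermTape = List (Bool × GTerm)

  headTerm : TermTape → GTerm
  headTerm []            = con 0
  headTerm ((_ , c) ∷ _) = c

  tapeFacts : TermTape → FactSet
  tapeFacts []             = gatom (# end) (con 0 ∷ []) ∷ []
  tapeFacts ((b , c) ∷ cs) = gatom (# cell b) (c ∷ headTerm cs ∷ []) ∷ tapeFacts cs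

  record Snapshot : Set where
    constructor snapshot
    field
      ctrl    : State
      scan    : Bool
      lhs rhs : TermTape
      clock   : GTerm
  open Snapshot

  snapshotFacts : Snapshot → FactSet
  snapshotFacts (snapshot q x l r t) =
    gatom (# confAt q x) (t ∷ headTerm l ∷ headTerm r ∷ []) ∷ tapeFacts l ++ tapeFacts r

  configOf : Snapshot → Config M
  configOf (snapshot q x l r _) = cfg q (map proj₁ l) x (map proj₁ r)

  data Outcome : Set where
    halts : Trigger KM → Outcome
    moves : Trigger KM → Snapshot → Outcome

  triggerOf : Outcome → Trigger KM
  triggerOf (halts tr)   = tr
  triggerOf (moves tr _) = tr

  assign₃ : GTerm → GTerm → GTerm → Subst
  assign₃ a b c = (0 , a) ∷ (1 , b) ∷ (2 , c) ∷ []

  assign₄ : GTerm → GTerm → GTerm → GTerm → Subst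
  assign₄ a b c d = (0 , a) ∷ (1 , b) ∷ (2 , c) ∷ (3 , d) ∷ []

  newTime newCell : Rule → Subst → GTerm
  newTime ρ σ = skSub ρ 0 ⟦ σ ⟧ 4
  newCell ρ σ = skSub ρ 0 ⟦ σ ⟧ 5

  stepRight : ∀ {q x q′ b} → δ M q x ≡ just (q′ , b , R) → TermTape → TermTape → GTerm → Outcome
  stepRight {q} {x} {q′} {b} e l [] t =
    moves (triggerAt p σ) (snapshot q′ false ((b , newCell ρ σ) ∷ l) [] (newTime ρ σ))
    where ρ = shiftRightAtEnd q x q′ b
          p = transition∈rules q x {ρ = ρ} e (here refl)
          σ = assign₃ t (headTerm l) (con 0)
  stepRight {q} {x} {q′} {b} e l ((x′ , c) ∷ r) t =
    moves (triggerAt p σ) (snapshot q′ x′ ((b , newCell ρ σ) ∷ l) r (newTime ρ σ))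
    where ρ = shiftRight q x q′ b x′
          p = transition∈rules q x {ρ = ρ} e (shiftRight∈ {q} {x} {q′} {b} x′)
          σ = assign₄ t (headTerm l) c (headTerm r)

  stepLeft : ∀ {q x q′ b} → δ M q x ≡ just (q′ , b , L) → TermTape → TermTape → GTerm → Outcome
  stepLeft {q} {x} {q′} {b} e [] r t =
    moves (triggerAt p σ) (snapshot q′ false [] ((b , newCell ρ σ) ∷ r) (newTime ρ σ))
    where ρ = shiftLeftAtEnd q x q′ b
          p = transition∈rules q x {ρ = ρ} e (here refl)
          σ = assign₃ t (con 0) (headTerm r)
  stepLeft {q} {x} {q′} {b} e ((x′ , c) ∷ l) r t =
    moves (triggerAt p σ) (snapshot q′ x′ l ((b , newCell ρ σ) ∷ r) (newTime ρ σ))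
    where ρ = shiftLeft q x q′ b x′
          p = transition∈rules q x {ρ = ρ} e (shiftLeft∈ {q} {x} {q′} {b} x′)
          σ = assign₄ t c (headTerm r) (headTerm l)

  stepWith : ∀ q x l r t {m} → δ M q x ≡ m → Outcome
  stepWith q x l r t {nothing} e =
    halts (triggerAt (transition∈rules q x e (here refl)) (assign₃ t (headTerm l) (headTerm r)))
  stepWith q x l r t {just (q′ , b , R)} e = stepRight e l r t
  stepWith q x l r t {just (q′ , b , L)} e = stepLeft e l r t

  simStep : Snapshot → Outcome
  simStep (snapshot q x l r t) = stepWith q x l r t refl

  record Applicable (s : Snapshot) (tr : Trigger KM) : Set where
    field
      loaded       : ∀ {F} → snapshotFacts s ⊆ F → Loaded F tr
      not-obsolete : ∀ {F} → Holds (Fresh (depth (clock s))) F → ¬ Obsolete F tr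

  record Advances (s : Snapshot) (tr : Trigger KM) (s′ : Snapshot) : Set where
    field
      steps     : stepTM (configOf s) ≡ just (configOf s′)
      covers    : ∀ {F} → snapshotFacts s ⊆ F → snapshotFacts s′ ⊆ F ++ outℕ tr 0
      fresh-out : Holds (Fresh (suc (depth (clock s)))) (outℕ tr 0)
      clock-suc : depth (clock s′) ≡ suc (depth (clock s))

  Effect : Snapshot → Outcome → Set
  Effect s (halts tr)    = stepTM (configOf s) ≡ nothing × outℕ tr 0 ≡ gatom (# halted) [] ∷ []
  Effect s (moves tr s′) = Advances s tr s′

  Correct : Snapshot → Outcome → Set
  Correct s o = Applicable s (triggerOf o) × Effect s o

  move-applicable : ∀ {q x scanned next written s} (p : moveRule q x scanned next written ∈ rulesM) σ →
    depth (⟦ σ ⟧ 0) ≡ depth (clock s) →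
    (∀ {F} → snapshotFacts s ⊆ F → LoadedRule F (moveRule q x scanned next written) σ) →
    Applicable s (triggerAt p σ)
  move-applicable {q} {x} {scanned} {next} {written} p σ depth≡ loads = record
    { loaded       = λ ⊆F → loaded-triggerAt p σ (loads ⊆F)
    ; not-obsolete = λ fresh obsolete →
        moveRule-not-obsolete q x scanned next written σ depth≡ fresh (obsolete-triggerAt p σ obsolete) }

  covers-out : ∀ {ρ} (p : ρ ∈ rulesM) σ {G F} → G ⊆ F ++ applyAtoms (skSub ρ 0 ⟦ σ ⟧) (head₀ ρ) →
               G ⊆ F ++ outℕ (triggerAt p σ) 0
  covers-out p σ {G} {F} = subst (λ O → G ⊆ F ++ O) (sym (out-triggerAt p σ))

  stepRight-correct : ∀ {q x q′ b} (e : δ M q x ≡ just (q′ , b , R)) l r t →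
                      Correct (snapshot q x l r t) (stepRight e l r t)
  stepRight-correct {q} {x} {q′} {b} e l [] t =
    move-applicable {q = q} {x = x} p σ refl loads ,
    record { steps = stepTM-moves {M} e ; covers = λ ⊆F → covers-out p σ (covers ⊆F)
           ; fresh-out = move-output-fresh q x q′ false b p σ ; clock-suc = refl }
    where
    ρ = shiftRightAtEnd q x q′ b
    p = transition∈rules q x {ρ = ρ} e (here refl)
    σ = assign₃ t (headTerm l) (con 0)
    loads : ∀ {F} → snapshotFacts (snapshot q x l [] t) ⊆ F → LoadedRule F ρ σ
    loads ⊆F (here refl)         = ⊆F (here refl)
    loads ⊆F (there (here refl)) = ⊆F (there (∈-++⁺ʳ (tapeFacts l) (here refl)))
    covers : ∀ {F} → snapshotFacts (snapshot q x l [] t) ⊆ F →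
             snapshotFacts (snapshot q′ false ((b , newCell ρ σ) ∷ l) [] (newTime ρ σ)) ⊆
             F ++ applyAtoms (skSub ρ 0 ⟦ σ ⟧) (head₀ ρ)
    covers {F} ⊆F (here refl)         = ∈-++⁺ʳ F (here refl)
    covers {F} ⊆F (there (here refl)) = ∈-++⁺ʳ F (there (here refl))
    covers {F} ⊆F (there (there m))   = ∈-++⁺ˡ (⊆F (there m))
  stepRight-correct {q} {x} {q′} {b} e l ((x′ , c) ∷ r) t =
    move-applicable {q = q} {x = x} p σ refl loads ,
    record { steps = stepTM-moves {M} e ; covers = λ ⊆F → covers-out p σ (covers ⊆F)
           ; fresh-out = move-output-fresh q x q′ x′ b p σ ; clock-suc = refl }
    where
    ρ = shiftRight q x q′ b x′
    p = transition∈rules q x {ρ = ρ} e (shiftRight∈ {q} {x} {q′} {b} x′)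
    σ = assign₄ t (headTerm l) c (headTerm r)
    loads : ∀ {F} → snapshotFacts (snapshot q x l ((x′ , c) ∷ r) t) ⊆ F → LoadedRule F ρ σ
    loads ⊆F (here refl)         = ⊆F (here refl)
    loads ⊆F (there (here refl)) = ⊆F (there (∈-++⁺ʳ (tapeFacts l) (here refl)))
    covers : ∀ {F} → snapshotFacts (snapshot q x l ((x′ , c) ∷ r) t) ⊆ F →
             snapshotFacts (snapshot q′ x′ ((b , newCell ρ σ) ∷ l) r (newTime ρ σ)) ⊆
             F ++ applyAtoms (skSub ρ 0 ⟦ σ ⟧) (head₀ ρ)
    covers {F} ⊆F (here refl)         = ∈-++⁺ʳ F (here refl)
    covers {F} ⊆F (there (here refl)) = ∈-++⁺ʳ F (there (here refl))
    covers {F} ⊆F (there (there m)) with ∈-++⁻ (tapeFacts l) m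
    ... | inj₁ m₁ = ∈-++⁺ˡ (⊆F (there (∈-++⁺ˡ m₁)))
    ... | inj₂ m₂ = ∈-++⁺ˡ (⊆F (there (∈-++⁺ʳ (tapeFacts l) (there m₂))))

  stepLeft-correct : ∀ {q x q′ b} (e : δ M q x ≡ just (q′ , b , L)) l r t →
                     Correct (snapshot q x l r t) (stepLeft e l r t)
  stepLeft-correct {q} {x} {q′} {b} e [] r t =
    move-applicable {q = q} {x = x} p σ refl loads ,
    record { steps = stepTM-moves {M} e ; covers = λ ⊆F → covers-out p σ (covers ⊆F)
           ; fresh-out = move-output-fresh q x q′ false b p σ ; clock-suc = refl }
    where
    ρ = shiftLeftAtEnd q x q′ b
    p = transition∈rules q x {ρ = ρ} e (here refl)
    σ = assign₃ t (con 0) (headTerm r)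
    loads : ∀ {F} → snapshotFacts (snapshot q x [] r t) ⊆ F → LoadedRule F ρ σ
    loads ⊆F (here refl)         = ⊆F (here refl)
    loads ⊆F (there (here refl)) = ⊆F (there (here refl))
    covers : ∀ {F} → snapshotFacts (snapshot q x [] r t) ⊆ F →
             snapshotFacts (snapshot q′ false [] ((b , newCell ρ σ) ∷ r) (newTime ρ σ)) ⊆
             F ++ applyAtoms (skSub ρ 0 ⟦ σ ⟧) (head₀ ρ)
    covers {F} ⊆F (here refl)                 = ∈-++⁺ʳ F (here refl)
    covers {F} ⊆F (there (here refl))         = ∈-++⁺ˡ (⊆F (there (here refl)))
    covers {F} ⊆F (there (there (here refl))) = ∈-++⁺ʳ F (there (here refl))
    covers {F} ⊆F (there (there (there m)))   = ∈-++⁺ˡ (⊆F (there (there m)))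
  stepLeft-correct {q} {x} {q′} {b} e ((x′ , c) ∷ l) r t =
    move-applicable {q = q} {x = x} p σ refl loads ,
    record { steps = stepTM-moves {M} e ; covers = λ ⊆F → covers-out p σ (covers ⊆F)
           ; fresh-out = move-output-fresh q x q′ x′ b p σ ; clock-suc = refl }
    where
    ρ = shiftLeft q x q′ b x′
    p = transition∈rules q x {ρ = ρ} e (shiftLeft∈ {q} {x} {q′} {b} x′)
    σ = assign₄ t c (headTerm r) (headTerm l)
    loads : ∀ {F} → snapshotFacts (snapshot q x ((x′ , c) ∷ l) r t) ⊆ F → LoadedRule F ρ σ
    loads ⊆F (here refl)         = ⊆F (here refl)
    loads ⊆F (there (here refl)) = ⊆F (there (here refl))
    covers : ∀ {F} → snapshotFacts (snapshot q x ((x′ , c) ∷ l) r t) ⊆ F →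
             snapshotFacts (snapshot q′ x′ l ((b , newCell ρ σ) ∷ r) (newTime ρ σ)) ⊆
             F ++ applyAtoms (skSub ρ 0 ⟦ σ ⟧) (head₀ ρ)
    covers {F} ⊆F (here refl) = ∈-++⁺ʳ F (here refl)
    covers {F} ⊆F (there m) with ∈-++⁻ (tapeFacts l) m
    ... | inj₁ m₁          = ∈-++⁺ˡ (⊆F (there (there (∈-++⁺ˡ m₁))))
    ... | inj₂ (here refl) = ∈-++⁺ʳ F (there (here refl))
    ... | inj₂ (there m₂)  = ∈-++⁺ˡ (⊆F (there (there (∈-++⁺ʳ (tapeFacts l) m₂))))

  stepWith-correct : ∀ q x l r t {m} (e : δ M q x ≡ m) → Correct (snapshot q x l r t) (stepWith q x l r t e)
  stepWith-correct q x l r t {nothing} e =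
    record { loaded       = λ ⊆F → loaded-triggerAt p σ λ { (here refl) → ⊆F (here refl) }
           ; not-obsolete = λ fresh obsolete →
               halt-not-obsolete {q = q} {x = x} σ fresh (obsolete-triggerAt p σ obsolete) } ,
    stepTM-halts {M} e , out-triggerAt p σ
    where p = transition∈rules q x {ρ = halt q x} e (here refl)
          σ = assign₃ t (headTerm l) (headTerm r)
  stepWith-correct q x l r t {just (q′ , b , R)} e = stepRight-correct e l r t
  stepWith-correct q x l r t {just (q′ , b , L)} e = stepLeft-correct e l r t

  simStep-correct : ∀ s → Correct s (simStep s)
  simStep-correct (snapshot q x l r t) = stepWith-correct q x l r t refl

  successor : Outcome → Maybe Snapshot
  successor (halts _)    = nothing
  successor (moves _ s′) = just s′

  successor-just : ∀ o {s′} → successor o ≡ just s′ → ∃ λ tr → o ≡ moves tr s′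
  successor-just (moves tr _) refl = tr , refl

  successor-nothing : ∀ o → successor o ≡ nothing → ∃ λ tr → o ≡ halts tr
  successor-nothing (halts tr) _ = tr , refl

  snapshotAt : ℕ → Maybe Snapshot
  snapshotAt zero    = just (snapshot fzero false [] [] (con 0))
  snapshotAt (suc j) = snapshotAt j >>= λ s → successor (simStep s)

  stopTrigger : Trigger KM
  stopTrigger = trigger fzero []

  scheduleFrom : Maybe Snapshot → Maybe Snapshot → Maybe (Trigger KM)
  scheduleFrom (just s) _        = just (triggerOf (simStep s))
  scheduleFrom nothing  (just _) = just stopTrigger
  scheduleFrom nothing  nothing  = nothing

  -- After the last simulated step (which derives halted) comes one application of halted⇒stop.
  schedule : ℕ → Maybe (Trigger KM)
  schedule zero    = scheduleFrom (snapshotAt zero) nothing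
  schedule (suc j) = scheduleFrom (snapshotAt (suc j)) (snapshotAt j)

  simTree : TreeData {KM}
  simTree = linear schedule

  open Linear schedule

  data Scheduled (j : ℕ) : Trigger KM → Set where
    simulating : ∀ {s} → snapshotAt j ≡ just s → Scheduled j (triggerOf (simStep s))
    stopping   : ∀ {j′ s} → j ≡ suc j′ → snapshotAt j′ ≡ just s → snapshotAt j ≡ nothing →
                 Scheduled j stopTrigger

  snapshotAt-suc : ∀ j {s} → snapshotAt j ≡ just s → snapshotAt (suc j) ≡ successor (simStep s)
  snapshotAt-suc j e rewrite e = refl

  scheduled : ∀ j {tr} → schedule j ≡ just tr → Scheduled j tr
  scheduled zero refl = simulating refl
  scheduled (suc j) e with snapshotAt j in e₀
  ... | just s with simStep s in step
  ...   | halts _    = subst (Scheduled (suc j)) (just-injective e) (stopping refl e₀ next≡)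
    where next≡ = trans (snapshotAt-suc j e₀) (cong successor step)
  ...   | moves _ s′ = subst (Scheduled (suc j)) (just-injective e) (simulating next≡)
    where next≡ = trans (snapshotAt-suc j e₀) (cong successor step)

  schedule-simulating : ∀ j {s} → snapshotAt j ≡ just s → schedule j ≡ just (triggerOf (simStep s))
  schedule-simulating zero    refl = refl
  schedule-simulating (suc j) e rewrite e = refl

  snapshotAt-moved : ∀ j {s′} → snapshotAt (suc j) ≡ just s′ →
                     ∃ λ s → ∃ λ tr → snapshotAt j ≡ just s × simStep s ≡ moves tr s′
  snapshotAt-moved j e with snapshotAt j
  ... | just s = s , proj₁ (successor-just (simStep s) e) , refl , proj₂ (successor-just (simStep s) e)

  snapshotAt-halted : ∀ j {s} → snapshotAt j ≡ just s → snapshotAt (suc j) ≡ nothing →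
                      ∃ λ tr → simStep s ≡ halts tr
  snapshotAt-halted j {s} e e′ = successor-nothing (simStep s) (trans (sym (snapshotAt-suc j e)) e′)

  snapshotAt-stuck : ∀ {i j} → snapshotAt i ≡ nothing → i ≤′ j → snapshotAt j ≡ nothing
  snapshotAt-stuck e (≤′-reflexive refl) = e
  snapshotAt-stuck e (≤′-step i≤′j) rewrite snapshotAt-stuck e i≤′j = refl

  simulation-runs : ∀ j {s} → snapshotAt j ≡ just s → run j (initial M) ≡ just (configOf s)
  simulation-runs zero    refl = refl
  simulation-runs (suc j) e with snapshotAt-moved j e
  ... | s , tr , e₀ , moved =
    trans (run-suc j _ (simulation-runs j e₀))
          (Advances.steps (subst (Effect s) moved (proj₂ (simStep-correct s))))

  record Invariant (j : ℕ) (s : Snapshot) : Set where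
    field
      facts⊆      : snapshotFacts s ⊆ pathLabel j
      fresh       : Holds (Fresh j) (pathLabel j)
      clock-depth : depth (clock s) ≡ j

  initial-fresh : Holds (Fresh 0) (pathLabel 0)
  initial-fresh (here refl)         = ⟪ tt ⟫
  initial-fresh (there (here refl)) = ⟪ tt ⟫

  invariant : ∀ j {s} → snapshotAt j ≡ just s → Invariant j s
  invariant zero refl = record
    { facts⊆      = λ { (here refl) → here refl ; (there (here refl)) → there (here refl)
                      ; (there (there (here refl))) → there (here refl) }
    ; fresh       = initial-fresh
    ; clock-depth = refl }
  invariant (suc j) {s′} e with snapshotAt-moved j e
  ... | s , tr , e₀ , moved = record
    { facts⊆      = λ m → subst (_ ∈_) (sym label≡) (Advances.covers advances (Invariant.facts⊆ I) m)
    ; fresh       = fresh′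
    ; clock-depth = trans (Advances.clock-suc advances) (cong suc (Invariant.clock-depth I)) }
    where
    I = invariant j e₀
    advances : Advances s tr s′
    advances = subst (Effect s) moved (proj₂ (simStep-correct s))
    label≡ : pathLabel (suc j) ≡ pathLabel j ++ outℕ tr 0
    label≡ = pathLabel-suc j (trans (schedule-simulating j e₀) (cong (just ∘ triggerOf) moved))
    fresh′ : Holds (Fresh (suc j)) (pathLabel (suc j))
    fresh′ m with ∈-++⁻ (pathLabel j) (subst (_ ∈_) label≡ m)
    ... | inj₁ m₁ = fresh-suc (Invariant.fresh I m₁)
    ... | inj₂ m₂ = subst (λ d → Fresh (suc d) _) (Invariant.clock-depth I) (Advances.fresh-out advances m₂)

  halted-step : ∀ j {s} → snapshotAt j ≡ just s → snapshotAt (suc j) ≡ nothing →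
                pathLabel (suc j) ≡ pathLabel j ++ gatom (# halted) [] ∷ []
  halted-step j {s} e e′ with snapshotAt-halted j e e′
  ... | tr , halting =
    trans (pathLabel-suc j (trans (schedule-simulating j e) (cong (just ∘ triggerOf) halting)))
          (cong (pathLabel j ++_) (proj₂ (proj₂ (subst (Correct s) halting (simStep-correct s)))))

  path-applicable : ∀ j {tr} → schedule j ≡ just tr → Loaded (pathLabel j) tr × ¬ Obsolete (pathLabel j) tr
  path-applicable j e with scheduled j e
  ... | simulating {s = s} e₀ =
    Applicable.loaded app (Invariant.facts⊆ I) ,
    Applicable.not-obsolete app
      (subst (λ d → Holds (Fresh d) (pathLabel j)) (sym (Invariant.clock-depth I)) (Invariant.fresh I))
    where I   = invariant j e₀
          app = proj₁ (simStep-correct s)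
  ... | stopping {j′} refl e₀ e₁ = loaded , not-obsolete
    where
    label≡ = halted-step j′ e₀ e₁
    loaded : Loaded (pathLabel (suc j′)) stopTrigger
    loaded (here refl) = subst (_ ∈_) (sym label≡) (∈-++⁺ʳ (pathLabel j′) (here refl))
    not-obsolete : ¬ Obsolete (pathLabel (suc j′)) stopTrigger
    not-obsolete (_ , _ , fzero , ⊆F) with ∈-++⁻ (pathLabel j′) (subst (_ ∈_) label≡ (⊆F (here refl)))
    ... | inj₁ m          = holds (Invariant.fresh (invariant j′ e₀) m)
    ... | inj₂ (here ())
    ... | inj₂ (there ())

  path-datalog-first : ∀ j {tr} → schedule j ≡ just tr → ¬ Datalog tr →
                       ∀ (μ : Trigger KM) → Datalog μ → Loaded (pathLabel j) μ → Obsolete (pathLabel j) μ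
  path-datalog-first j e ¬datalog μ datalog loaded with scheduled j e
  ... | simulating e₀ = ⊥-elim (holds (Invariant.fresh (invariant j e₀) (loaded halted∈)))
    where halted∈ = subst (λ bd → gatom (# halted) [] ∈ applyAtoms ⟦ sub μ ⟧ bd)
                          (sym (datalog-body (∈-lookup {xs = rulesM} (idx μ)) (proj₁ datalog))) (here refl)
  ... | stopping _ _ _ = ⊥-elim (¬datalog (refl , λ _ ()))

  stop-obsoletes : ∀ {F} → gatom (# stop) [] ∈ F → ∀ (μ : Trigger KM) → Obsolete F μ
  stop-obsoletes {F} stop∈ μ with stop-disjunct (∈-lookup {xs = rulesM} (idx μ))
  ... | i , head≡ = ⟦ sub μ ⟧ , (λ _ _ → refl) , i ,
                    subst (λ h → applyAtoms ⟦ sub μ ⟧ h ⊆ F) (sym head≡) λ { (here refl) → stop∈ }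

  second-disjunct : ∀ (λ′ : Trigger KM) → heads (ruleOf λ′) ≡ stopDisjunct → outℕ λ′ 1 ≡ gatom (# stop) [] ∷ []
  second-disjunct λ′ eq rewrite eq = refl

  later-disjunct-stops : ∀ (λ′ : Trigger KM) (i : Fin (length (heads (ruleOf λ′)))) →
                         gatom (# stop) [] ∈ outℕ λ′ (suc (toℕ i))
  later-disjunct-stops λ′ i with heads-cases (∈-lookup {xs = rulesM} (idx λ′))
  ... | inj₁ eq with subst (toℕ i <_) (cong length eq) (toℕ<n i)
  ...   | ()
  later-disjunct-stops λ′ i | inj₂ eq
    rewrite n<1⇒n≡0 (subst (toℕ i <_) (cong length eq) (toℕ<n i)) =
      subst (_ ∈_) (sym (second-disjunct λ′ eq)) (here refl)

  schedule-continues : ∀ j {s} → snapshotAt j ≡ just s → schedule (suc j) ≢ nothing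
  schedule-continues j {s} e rewrite e with successor (simStep s)
  ... | just _  = λ ()
  ... | nothing = λ ()

  leaf-stopped : ∀ {a} → Vertex simTree a → simTree a ≡ nothing → gatom (# stop) [] ∈ label simTree a
  leaf-stopped (child {a} {λ′} v e fzero) leaf with linear-just a e
  ... | a≡zeros , scheduled-a with scheduled (length a) scheduled-a
  ...   | simulating e₀ =
    ⊥-elim (schedule-continues (length a) e₀
              (trans (sym (linear-zeros (suc (length a)))) (subst (λ z → simTree (0 ∷ z) ≡ nothing) a≡zeros leaf)))
  ...   | stopping _ _ _ = subst (_ ∈_) (sym (label-child simTree a 0 e)) (∈-++⁺ʳ (label simTree a) (here refl))
  leaf-stopped (child {a} {λ′} v e (fsuc i)) leaf =
    subst (_ ∈_) (sym (label-child simTree a (suc (toℕ i)) e))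
                 (∈-++⁺ʳ (label simTree a) (later-disjunct-stops λ′ i))

  fresh-not-goal : ∀ {j a} → Fresh j a → GAtom.gpred a ≢ # goal
  fresh-not-goal {a = gatom _ _} fresh refl = holds fresh

  step-goal-free : ∀ s {a} → a ∈ outℕ (triggerOf (simStep s)) 0 → GAtom.gpred a ≢ # goal
  step-goal-free s m with simStep s | simStep-correct s
  ... | halts _   | _ , _ , out≡  with subst (_ ∈_) out≡ m
  ...   | here refl = λ ()
  step-goal-free s m | moves _ _ | _ , advances = fresh-not-goal (Advances.fresh-out advances m)

  path-goal-free : ∀ j {a} → a ∈ pathLabel j → GAtom.gpred a ≢ # goal
  path-goal-free zero (here refl)         = λ ()
  path-goal-free zero (there (here refl)) = λ ()
  path-goal-free (suc j) m with schedule j in e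
  ... | nothing = path-goal-free j (subst (_ ∈_) (pathLabel-stuck j e) m)
  ... | just tr with ∈-++⁻ (pathLabel j) (subst (_ ∈_) (pathLabel-suc j e) m) | scheduled j e
  ...   | inj₁ m₁          | _              = path-goal-free j m₁
  ...   | inj₂ m₂          | simulating {s} _ = step-goal-free s m₂
  ...   | inj₂ (here refl) | stopping _ _ _ = λ ()

  on-path : ∀ a {λ′} (P : FactSet → Set) → simTree a ≡ just λ′ →
            (schedule (length a) ≡ just λ′ → P (pathLabel (length a))) → P (label simTree a)
  on-path a P e holds-on-path with linear-just a e
  ... | a≡zeros , sched = subst (λ z → P (label simTree z)) (sym a≡zeros) (holds-on-path sched)

  LastSnapshot : Set
  LastSnapshot = ∃ λ H → ∃ λ s → snapshotAt H ≡ just s × snapshotAt (suc H) ≡ nothing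

  last-snapshot : ∀ j → snapshotAt j ≡ nothing → LastSnapshot
  last-snapshot (suc j) e = before (snapshotAt j) refl
    where
    before : ∀ m → snapshotAt j ≡ m → LastSnapshot
    before (just s) e₀ = j , s , e₀ , e
    before nothing  e₀ = last-snapshot j e₀

  halting-snapshot : Halts M → LastSnapshot
  halting-snapshot (k , stops) with snapshotAt (suc k) in e
  ... | nothing = last-snapshot (suc k) e
  ... | just s with trans (sym (simulation-runs (suc k) e)) stops
  ...   | ()

  module Halting (H : ℕ) {s} (last : snapshotAt H ≡ just s) (stuck : snapshotAt (suc H) ≡ nothing) where

    snapshot-within : ∀ {j s′} → snapshotAt j ≡ just s′ → j ≤ H
    snapshot-within {j} e with j ≤? H
    ... | yes j≤H = j≤H
    ... | no  j≰H with trans (sym (snapshotAt-stuck stuck (≤⇒≤′ (≰⇒> j≰H)))) e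
    ...   | ()

    schedule-within : ∀ j {tr} → schedule j ≡ just tr → j < suc (suc H)
    schedule-within j e with scheduled j e
    ... | simulating e₀       = s≤s (m≤n⇒m≤1+n (snapshot-within e₀))
    ... | stopping refl e₀ _  = s≤s (s≤s (snapshot-within e₀))

    scheduled-before : ∀ i → i < suc H → ∃ λ tr → schedule i ≡ just tr
    scheduled-before i (s≤s i≤H) with snapshotAt i in e
    ... | just s′ = triggerOf (simStep s′) , schedule-simulating i e
    ... | nothing with trans (sym (snapshotAt-stuck e (≤⇒≤′ i≤H))) last
    ...   | ()

    simTree-chase : IsChaseTree simTree
    simTree-chase = record
      { applied-ok    = λ {a} {λ′} _ e →
          on-path a (λ F → Loaded F λ′ × ¬ Obsolete F λ′) e (path-applicable (length a))
      ; datalog-first = λ {a} _ e ¬datalog μ datalog →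
          on-path a (λ F → Loaded F μ → Obsolete F μ) e (λ sched → path-datalog-first (length a) sched ¬datalog μ datalog)
      ; leaf-model    = λ v leaf μ _ → stop-obsoletes (leaf-stopped v leaf) μ
      ; fair          = fair-if-shallow (suc (suc H)) (vertex-depth (suc (suc H)) schedule-within) }

    goal-loaded : Loaded (pathLabel (suc H)) goalTrigger
    goal-loaded (here refl) = subst (_ ∈_) (sym (halted-step H last stuck)) (∈-++⁺ʳ (pathLabel H) (here refl))

    ¬gunblockable : ¬ GUnblockable {KM} (leftmost {KM}) goalTrigger
    ¬gunblockable gunblockable
      with gunblockable simTree simTree-chase (zeros {KM} (suc H)) (zeros-on-branch (suc H) scheduled-before)
                        goal-loaded
    ... | u , on-branch , out⊆ =
      path-goal-free (length u) (subst (λ z → _ ∈ label simTree z) (leftmost-branch on-branch) (out⊆ (here refl)))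
                     refl

  halting⇒¬gunblockable : Halts M → ¬ GUnblockable {KM} (leftmost {KM}) goalTrigger
  halting⇒¬gunblockable h with halting-snapshot h
  ... | H , _ , last , stuck = Halting.¬gunblockable H last stuck

theorem2 : Σ (TM → Instance) (λ red →
             (∀ (M : TM) → Halts M ⇔ GUProblem (red M))
             ⊎ (∀ (M : TM) → (¬ Halts M) ⇔ GUProblem (red M)))
theorem2 = (λ M → inst (KM M) (leftmost {KM M}) (goalTrigger M)) ,
           inj₂ (λ M → mk⇔ (nonhalting⇒gunblockable M)
                           (λ gunblockable halts → halting⇒¬gunblockable M halts gunblockable))
  where open Reduction
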